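{- Let $\Pi=\{\pi_1,\ldots,\pi_\ell\}$ be a partition of $[n]=\{1,\ldots,n\}$ and let $C'=(c'_{ij})$ be an $n\times n$ matrix satisfying $c'_{ij}=c'_{kj}$ for all $i,k$ in the same part $\pi_a$ of $\Pi$ and all $j\in[n]$. Then $C'$ and its quotient matrix $\Pi(C')$ with respect to $\Pi$ have the same set of nonzero eigenvalues. In particular, $\rho(C')=\rho(\Pi(C'))$.
   Context: All matrices are real; eigenvalues are complex eigenvalues and $\rho$ denotes the spectral radius (maximum modulus of eigenvalues). The quotient matrix of $C'$ with respect to $\Pi$ is the $\ell\times\ell$ matrix $\Pi(C')=(\pi'_{ab})$ with $\pi'_{ab}=\frac{1}{|\pi_a|}\sum_{i\in\pi_a,\,j\in\pi_b}c'_{ij}$. -}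

module Defs where

open import Level using (0ℓ)
open import Algebra.Bundles.Raw using (RawMonoid)
import Algebra.Definitions.RawMonoid as RawMonoidDefinitions
open import Data.Bool.Base using (if_then_else_)
open import Data.Fin.Base using (Fin; suc)
open import Data.Fin.Subset using (Subset; inside; outside; _∈_; Nonempty; ∣_∣)
open import Data.Fin.Subset.Properties using (_∈?_; drop-there)
open import Data.Integer.Base using (+_)
open import Data.Nat.Base as ℕ using (ℕ; _⊔_)
import Data.Nat.Properties as ℕ
open import Data.Product using (∃; _×_; _,_)
open import Data.Rational.Base as ℚ using (ℚ; 0ℚ; 1ℚ; ½)
import Data.Rational.Properties as ℚ
open import Data.Rational.Solver using (module +-*-Solver)
open import Data.Vec.Base using (_∷_)
open import Data.Vec.Functional using (Vector)
open import Relation.Binary.PropositionalEquality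
  using (_≡_; refl; sym; cong; subst; module ≡-Reasoning)
open import Relation.Nullary.Decidable using (does)
open import Relation.Nullary.Negation using (¬_)

------------------------------------------------------------------------
-- Real numbers: Cauchy sequences of rationals, with the setoid equality
-- "the difference tends to 0".

IsCauchy : (ℕ → ℚ) → Set
IsCauchy x = ∀ ε → 0ℚ ℚ.< ε →
  ∃ λ N → ∀ m n → N ℕ.≤ m → N ℕ.≤ n → ℚ.∣ x m ℚ.- x n ∣ ℚ.< ε

record ℝ : Set where
  constructor mkℝ
  field
    seq    : ℕ → ℚ
    cauchy : IsCauchy seq

open ℝ public

infix 4 _≈_ _≤_

record _≈_ (x y : ℝ) : Set where
  constructor mk≈
  field
    close : ∀ ε → 0ℚ ℚ.< ε →
      ∃ λ N → ∀ n → N ℕ.≤ n → ℚ.∣ seq x n ℚ.- seq y n ∣ ℚ.< ε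

record _≤_ (x y : ℝ) : Set where
  constructor mk≤
  field
    below : ∀ ε → 0ℚ ℚ.< ε →
      ∃ λ N → ∀ n → N ℕ.≤ n → seq x n ℚ.< seq y n ℚ.+ ε

open _≈_ public
open _≤_ public

fromℚ : ℚ → ℝ
fromℚ q = mkℝ (λ _ → q) λ ε 0<ε →
  0 , λ _ _ _ _ → subst (ℚ._< ε) (sym (cong ℚ.∣_∣ (ℚ.+-inverseʳ q))) 0<ε

0ℝ : ℝ
0ℝ = fromℚ 0ℚ

abstract

  ½+½ : ∀ p → ½ ℚ.* p ℚ.+ ½ ℚ.* p ≡ p
  ½+½ = solve 1 (λ p → con ½ :* p :+ con ½ :* p := p) refl
    where open +-*-Solver

  0<½* : ∀ {p} → 0ℚ ℚ.< p → 0ℚ ℚ.< ½ ℚ.* p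
  0<½* {p} 0<p = subst (ℚ._< ½ ℚ.* p) (ℚ.*-zeroʳ ½) (ℚ.*-monoʳ-<-pos ½ 0<p)

  +-cauchy : ∀ {x y} → IsCauchy x → IsCauchy y → IsCauchy (λ n → x n ℚ.+ y n)
  +-cauchy {x} {y} cx cy ε 0<ε with cx (½ ℚ.* ε) (0<½* 0<ε) | cy (½ ℚ.* ε) (0<½* 0<ε)
  ... | M , hx | N , hy = M ⊔ N , λ m n ≤m ≤n → begin-strict
    ℚ.∣ (x m ℚ.+ y m) ℚ.- (x n ℚ.+ y n) ∣
      ≡⟨ cong ℚ.∣_∣ (rearrange (x m) (y m) (x n) (y n)) ⟩
    ℚ.∣ (x m ℚ.- x n) ℚ.+ (y m ℚ.- y n) ∣
      ≤⟨ ℚ.∣p+q∣≤∣p∣+∣q∣ (x m ℚ.- x n) (y m ℚ.- y n) ⟩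
    ℚ.∣ x m ℚ.- x n ∣ ℚ.+ ℚ.∣ y m ℚ.- y n ∣
      <⟨ ℚ.+-mono-<
           (hx m n (ℕ.m⊔n≤o⇒m≤o M N ≤m) (ℕ.m⊔n≤o⇒m≤o M N ≤n))
           (hy m n (ℕ.m⊔n≤o⇒n≤o M N ≤m) (ℕ.m⊔n≤o⇒n≤o M N ≤n)) ⟩
    ½ ℚ.* ε ℚ.+ ½ ℚ.* ε
      ≡⟨ ½+½ ε ⟩
    ε ∎
    where
    open ℚ.≤-Reasoning
    open +-*-Solver
    rearrange : ∀ a b c d → (a ℚ.+ b) ℚ.- (c ℚ.+ d) ≡ (a ℚ.- c) ℚ.+ (b ℚ.- d)
    rearrange = solve 4 (λ a b c d → (a :+ b) :- (c :+ d) := (a :- c) :+ (b :- d)) refl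

  neg-cauchy : ∀ {x} → IsCauchy x → IsCauchy (λ n → ℚ.- x n)
  neg-cauchy {x} cx ε 0<ε with cx ε 0<ε
  ... | N , h = N , λ m n ≤m ≤n → subst (ℚ._< ε)
    (cong ℚ.∣_∣ (swap (x n) (x m))) (h n m ≤n ≤m)
    where
    open +-*-Solver
    swap : ∀ a b → a ℚ.- b ≡ (ℚ.- b) ℚ.- (ℚ.- a)
    swap = solve 2 (λ a b → a :- b := (:- b) :- (:- a)) refl

  eventually-bounded : ∀ {x} → IsCauchy x →
    ∃ λ K → 0ℚ ℚ.< K × ∃ λ N → ∀ n → N ℕ.≤ n → ℚ.∣ x n ∣ ℚ.≤ K
  eventually-bounded {x} cx with cx 1ℚ (ℚ.positive⁻¹ 1ℚ)
  ... | N , h = 1ℚ ℚ.+ ℚ.∣ x N ∣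
              , ℚ.+-mono-<-≤ (ℚ.positive⁻¹ 1ℚ) (ℚ.0≤∣p∣ (x N))
              , N , λ n ≤n → begin
    ℚ.∣ x n ∣
      ≡⟨ cong ℚ.∣_∣ (split (x n) (x N)) ⟩
    ℚ.∣ (x n ℚ.- x N) ℚ.+ x N ∣
      ≤⟨ ℚ.∣p+q∣≤∣p∣+∣q∣ (x n ℚ.- x N) (x N) ⟩
    ℚ.∣ x n ℚ.- x N ∣ ℚ.+ ℚ.∣ x N ∣
      ≤⟨ ℚ.+-monoˡ-≤ ℚ.∣ x N ∣ (ℚ.<⇒≤ (h n N ≤n ℕ.≤-refl)) ⟩
    1ℚ ℚ.+ ℚ.∣ x N ∣ ∎
    where
    open ℚ.≤-Reasoning
    open +-*-Solver
    split : ∀ a b → a ≡ (a ℚ.- b) ℚ.+ b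
    split = solve 2 (λ a b → a := (a :- b) :+ b) refl

  ∣*∣<* : ∀ {p q B δ} → 0ℚ ℚ.< B → ℚ.∣ p ∣ ℚ.≤ B → ℚ.∣ q ∣ ℚ.< δ →
          ℚ.∣ p ℚ.* q ∣ ℚ.< B ℚ.* δ
  ∣*∣<* {p} {q} {B} {δ} 0<B p≤B q<δ = begin-strict
    ℚ.∣ p ℚ.* q ∣         ≡⟨ ℚ.∣p*q∣≡∣p∣*∣q∣ p q ⟩
    ℚ.∣ p ∣ ℚ.* ℚ.∣ q ∣   ≤⟨ ℚ.*-monoʳ-≤-nonNeg ℚ.∣ q ∣ {{ℚ.∣-∣-nonNeg q}} p≤B ⟩
    B ℚ.* ℚ.∣ q ∣         <⟨ ℚ.*-monoʳ-<-pos B {{ℚ.positive 0<B}} q<δ ⟩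
    B ℚ.* δ               ∎
    where open ℚ.≤-Reasoning

  ∣*-*∣< : ∀ {a b c d K L δ} → 0ℚ ℚ.< K → 0ℚ ℚ.< L →
           ℚ.∣ a ∣ ℚ.≤ K → ℚ.∣ d ∣ ℚ.≤ L → ℚ.∣ a ℚ.- c ∣ ℚ.< δ → ℚ.∣ b ℚ.- d ∣ ℚ.< δ →
           ℚ.∣ a ℚ.* b ℚ.- c ℚ.* d ∣ ℚ.< (K ℚ.+ L) ℚ.* δ
  ∣*-*∣< {a} {b} {c} {d} {K} {L} {δ} 0<K 0<L a≤K d≤L a-c<δ b-d<δ = begin-strict
    ℚ.∣ a ℚ.* b ℚ.- c ℚ.* d ∣
      ≡⟨ cong ℚ.∣_∣ (rearrange a b c d) ⟩
    ℚ.∣ a ℚ.* (b ℚ.- d) ℚ.+ d ℚ.* (a ℚ.- c) ∣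
      ≤⟨ ℚ.∣p+q∣≤∣p∣+∣q∣ (a ℚ.* (b ℚ.- d)) (d ℚ.* (a ℚ.- c)) ⟩
    ℚ.∣ a ℚ.* (b ℚ.- d) ∣ ℚ.+ ℚ.∣ d ℚ.* (a ℚ.- c) ∣
      <⟨ ℚ.+-mono-< {ℚ.∣ a ℚ.* (b ℚ.- d) ∣} {K ℚ.* δ}
                    {ℚ.∣ d ℚ.* (a ℚ.- c) ∣} {L ℚ.* δ}
           (∣*∣<* {a} {b ℚ.- d} {K} {δ} 0<K a≤K b-d<δ)
           (∣*∣<* {d} {a ℚ.- c} {L} {δ} 0<L d≤L a-c<δ) ⟩
    K ℚ.* δ ℚ.+ L ℚ.* δ
      ≡⟨ ℚ.*-distribʳ-+ δ K L ⟨
    (K ℚ.+ L) ℚ.* δ ∎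
    where
    open ℚ.≤-Reasoning
    open +-*-Solver
    rearrange : ∀ a b c d →
      a ℚ.* b ℚ.- c ℚ.* d ≡ a ℚ.* (b ℚ.- d) ℚ.+ d ℚ.* (a ℚ.- c)
    rearrange = solve 4 (λ a b c d →
      a :* b :- c :* d := a :* (b :- d) :+ d :* (a :- c)) refl

  divide : ∀ {K ε} → 0ℚ ℚ.< K → 0ℚ ℚ.< ε → ∃ λ δ → 0ℚ ℚ.< δ × K ℚ.* δ ≡ ε
  divide {K} {ε} 0<K 0<ε = K⁻¹ ℚ.* ε , 0<K⁻¹*ε , (begin
    K ℚ.* (K⁻¹ ℚ.* ε)   ≡⟨ ℚ.*-assoc K K⁻¹ ε ⟨
    K ℚ.* K⁻¹ ℚ.* ε     ≡⟨ cong (ℚ._* ε) (ℚ.*-inverseʳ K) ⟩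
    1ℚ ℚ.* ε            ≡⟨ ℚ.*-identityˡ ε ⟩
    ε                   ∎)
    where
    open ≡-Reasoning
    instance
      K>0 : ℚ.Positive K
      K>0 = ℚ.positive 0<K
      K≢0 : ℚ.NonZero K
      K≢0 = ℚ.pos⇒nonZero K
    K⁻¹ : ℚ
    K⁻¹ = ℚ.1/ K
    0<K⁻¹*ε : 0ℚ ℚ.< K⁻¹ ℚ.* ε
    0<K⁻¹*ε = ℚ.positive⁻¹ (K⁻¹ ℚ.* ε)
      {{ℚ.pos*pos⇒pos K⁻¹ {{ℚ.1/pos⇒pos K}} ε {{ℚ.positive 0<ε}}}}

  0<+ : ∀ {p q} → 0ℚ ℚ.< p → 0ℚ ℚ.< q → 0ℚ ℚ.< p ℚ.+ q
  0<+ {p} {q} 0<p 0<q = ℚ.positive⁻¹ (p ℚ.+ q)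
    {{ℚ.pos+pos⇒pos p {{ℚ.positive 0<p}} q {{ℚ.positive 0<q}}}}

  *-cauchy′ : ∀ {x y} → IsCauchy x → IsCauchy y → ∀ K L δ P Q → 0ℚ ℚ.< K → 0ℚ ℚ.< L →
    (∀ n → P ℕ.≤ n → ℚ.∣ x n ∣ ℚ.≤ K) → (∀ n → Q ℕ.≤ n → ℚ.∣ y n ∣ ℚ.≤ L) → 0ℚ ℚ.< δ →
    ∃ λ N → ∀ m n → N ℕ.≤ m → N ℕ.≤ n →
      ℚ.∣ x m ℚ.* y m ℚ.- x n ℚ.* y n ∣ ℚ.< (K ℚ.+ L) ℚ.* δ
  *-cauchy′ {x} {y} cx cy K L δ P Q 0<K 0<L hK hL 0<δ with cx δ 0<δ | cy δ 0<δ
  ... | M , hx | N , hy = (P ⊔ Q) ⊔ (M ⊔ N) , λ m n ≤m ≤n →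
    let PQ≤m = ℕ.m⊔n≤o⇒m≤o (P ⊔ Q) (M ⊔ N) ≤m
        PQ≤n = ℕ.m⊔n≤o⇒m≤o (P ⊔ Q) (M ⊔ N) ≤n
        MN≤m = ℕ.m⊔n≤o⇒n≤o (P ⊔ Q) (M ⊔ N) ≤m
        MN≤n = ℕ.m⊔n≤o⇒n≤o (P ⊔ Q) (M ⊔ N) ≤n
    in ∣*-*∣< {x m} {y m} {x n} {y n} {K} {L} {δ} 0<K 0<L
         (hK m (ℕ.m⊔n≤o⇒m≤o P Q PQ≤m)) (hL n (ℕ.m⊔n≤o⇒n≤o P Q PQ≤n))
         (hx m n (ℕ.m⊔n≤o⇒m≤o M N MN≤m) (ℕ.m⊔n≤o⇒m≤o M N MN≤n))
         (hy m n (ℕ.m⊔n≤o⇒n≤o M N MN≤m) (ℕ.m⊔n≤o⇒n≤o M N MN≤n))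

  *-cauchy : ∀ {x y} → IsCauchy x → IsCauchy y → IsCauchy (λ n → x n ℚ.* y n)
  *-cauchy {x} {y} cx cy ε 0<ε =
    let K , 0<K , P , hK = eventually-bounded {x} cx
        L , 0<L , Q , hL = eventually-bounded {y} cy
        δ , 0<δ , eq     = divide {K ℚ.+ L} {ε} (0<+ {K} {L} 0<K 0<L) 0<ε
        N , h            = *-cauchy′ {x} {y} cx cy K L δ P Q 0<K 0<L hK hL 0<δ
    in N , λ m n ≤m ≤n →
       ℚ.<-≤-trans {ℚ.∣ x m ℚ.* y m ℚ.- x n ℚ.* y n ∣} {(K ℚ.+ L) ℚ.* δ} {ε}
         (h m n ≤m ≤n) (ℚ.≤-reflexive eq)

infixl 6 _+_ _-_
infixl 7 _*_
infix  8 -_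

_+_ : ℝ → ℝ → ℝ
x + y = mkℝ (λ n → seq x n ℚ.+ seq y n) (+-cauchy {seq x} {seq y} (cauchy x) (cauchy y))

-_ : ℝ → ℝ
- x = mkℝ (λ n → ℚ.- seq x n) (neg-cauchy {seq x} (cauchy x))

_-_ : ℝ → ℝ → ℝ
x - y = x + - y

_*_ : ℝ → ℝ → ℝ
x * y = mkℝ (λ n → seq x n ℚ.* seq y n) (*-cauchy {seq x} {seq y} (cauchy x) (cauchy y))

ℝ-+-rawMonoid : RawMonoid 0ℓ 0ℓ
ℝ-+-rawMonoid = record { Carrier = ℝ ; _≈_ = _≈_ ; _∙_ = _+_ ; ε = 0ℝ }

open RawMonoidDefinitions ℝ-+-rawMonoid public using () renaming (sum to sumℝ)

------------------------------------------------------------------------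
-- Complex numbers

record ℂ : Set where
  constructor _+i_
  field
    re im : ℝ

open ℂ public

infix  4 _≈ᶜ_
infixl 6 _+ᶜ_
infixl 7 _*ᶜ_

_≈ᶜ_ : ℂ → ℂ → Set
z ≈ᶜ w = re z ≈ re w × im z ≈ im w

fromℝ : ℝ → ℂ
fromℝ x = x +i 0ℝ

0ℂ : ℂ
0ℂ = fromℝ 0ℝ

_+ᶜ_ : ℂ → ℂ → ℂ
z +ᶜ w = (re z + re w) +i (im z + im w)

_*ᶜ_ : ℂ → ℂ → ℂ
z *ᶜ w = (re z * re w - im z * im w) +i (re z * im w + im z * re w)

ℂ-+-rawMonoid : RawMonoid 0ℓ 0ℓ
ℂ-+-rawMonoid = record { Carrier = ℂ ; _≈_ = _≈ᶜ_ ; _∙_ = _+ᶜ_ ; ε = 0ℂ }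

open RawMonoidDefinitions ℂ-+-rawMonoid public using () renaming (sum to sumℂ)

-- r = |z|, i.e. r is the nonnegative square root of (re z)² + (im z)².
IsModulus : ℂ → ℝ → Set
IsModulus z r = 0ℝ ≤ r × r * r ≈ re z * re z + im z * im z

------------------------------------------------------------------------
-- Real square matrices, their complex eigenvalues and spectral radius

Matrix : ℕ → Set
Matrix n = Fin n → Fin n → ℝ

IsEigenvalue : ∀ {n} → Matrix n → ℂ → Set
IsEigenvalue {n} A z = ∃ λ (v : Vector ℂ n) →
  ¬ (∀ i → v i ≈ᶜ 0ℂ) ×
  (∀ i → sumℂ (λ j → fromℝ (A i j) *ᶜ v j) ≈ᶜ z *ᶜ v i)

-- r = ρ(A).  This is a relation because a maximum over the spectrum is not
-- computable as a function of A; it determines r up to _≈_.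
record IsSpectralRadius {n} (A : Matrix n) (r : ℝ) : Set where
  field
    attained : ∃ λ z → IsEigenvalue A z × IsModulus z r
    maximal  : ∀ {z s} → IsEigenvalue A z → IsModulus z s → s ≤ r

------------------------------------------------------------------------
-- Partitions and quotient matrices

record IsPartition {n ℓ} (π : Fin ℓ → Subset n) : Set where
  field
    nonempty : ∀ a → Nonempty (π a)
    disjoint : ∀ {a b i} → i ∈ π a → i ∈ π b → a ≡ b
    cover    : ∀ i → ∃ λ a → i ∈ π a

nonempty⇒∣p∣≢0 : ∀ {n} {p : Subset n} → Nonempty p → ℕ.NonZero ∣ p ∣
nonempty⇒∣p∣≢0 {p = inside  ∷ p} _               = _
nonempty⇒∣p∣≢0 {p = outside ∷ p} (suc i , i∈p) = nonempty⇒∣p∣≢0 (i , drop-there i∈p)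

∑∈ : ∀ {n} → Subset n → Vector ℝ n → ℝ
∑∈ p f = sumℝ (λ i → if does (i ∈? p) then f i else 0ℝ)

quotient : ∀ {n ℓ} (π : Fin ℓ → Subset n) → IsPartition π → Matrix n → Matrix ℓ
quotient π part C a b =
  fromℚ ((+ 1 ℚ./ ∣ π a ∣) {{nonempty⇒∣p∣≢0 (IsPartition.nonempty part a)}})
  * ∑∈ (π a) (λ i → ∑∈ (π b) (λ j → C i j))

{-# OPTIONS --safe #-}

-- Let S be the n × ℓ incidence matrix of the partition.  The rows of C′ being
-- constant on parts gives the intertwining relation C′ S = S Π(C′), so
-- eigenvectors of Π(C′) lift along S.  Conversely C′ v = z v with z ≠ 0 forces
-- v to be constant on parts, so v lies in the image of S.
--
-- Constructively, cancelling z and comparing the spectral radii (which needs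
-- the case split z = 0 or z ≠ 0) rest on ¬¬-stability of equality of reals.

module Submission where

open import Defs
open import Algebra.Bundles using (CommutativeRing)
open import Data.Bool.Base using (if_then_else_)
open import Data.Fin.Base using (Fin; zero; suc)
open import Data.Fin.Subset using (Subset; _∈_; inside; outside; ∣_∣)
open import Data.Fin.Subset.Properties using (_∈?_)
open import Data.Integer.Base as ℤ using (+_)
import Data.Integer.Properties as ℤ
open import Data.Nat.Base as ℕ using (ℕ; suc; _⊔_)
import Data.Nat.Properties as ℕ
open import Data.Product using (∃; _×_; _,_; proj₁; proj₂)
open import Data.Rational.Base as ℚ using (ℚ; 0ℚ; 1ℚ; ½)
import Data.Rational.Properties as ℚ
open import Data.Rational.Solver using (module +-*-Solver)
import Data.Rational.Unnormalised.Base as ℚᵘ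
import Data.Rational.Unnormalised.Properties as ℚᵘ
open import Data.Sum.Base using (inj₁; inj₂)
open import Data.Vec.Base using ([]; _∷_)
open import Data.Vec.Functional using (Vector)
open import Function.Base using (_∘_)
open import Function.Bundles using (_⇔_; mk⇔)
open import Level using (0ℓ)
import Relation.Binary.Reasoning.Setoid as SetoidReasoning
open import Relation.Binary.PropositionalEquality
  using (_≡_; refl; sym; trans; cong; cong₂; subst)
open import Relation.Nullary.Decidable using (does; yes; no; dec-true; dec-false)
open import Relation.Nullary.Negation using (¬_; contradiction)

open +-*-Solver

-- Real and complex arithmetic

-- The field `close` of `x ≈ y` is by definition nullity of the termwise difference, so the laws of
-- `_≈_` reduce to closure properties of null sequences.
IsNull : (ℕ → ℚ) → Set
IsNull s = ∀ ε → 0ℚ ℚ.< ε → ∃ λ N → ∀ n → N ℕ.≤ n → ℚ.∣ s n ∣ ℚ.< ε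

null-resp : ∀ s t → (∀ n → s n ≡ t n) → IsNull s → IsNull t
null-resp s t s≡t hs ε 0<ε =
  let N , h = hs ε 0<ε
  in N , λ n N≤n → subst (λ q → ℚ.∣ q ∣ ℚ.< ε) (s≡t n) (h n N≤n)

null-0 : IsNull (λ _ → 0ℚ)
null-0 ε 0<ε = 0 , λ _ _ → 0<ε

null-+ : ∀ s t → IsNull s → IsNull t → IsNull (λ n → s n ℚ.+ t n)
null-+ s t hs ht ε 0<ε =
  let M , h = hs (½ ℚ.* ε) (0<½* 0<ε)
      N , k = ht (½ ℚ.* ε) (0<½* 0<ε)
  in M ⊔ N , λ n ≤n → begin-strict
    ℚ.∣ s n ℚ.+ t n ∣
      ≤⟨ ℚ.∣p+q∣≤∣p∣+∣q∣ (s n) (t n) ⟩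
    ℚ.∣ s n ∣ ℚ.+ ℚ.∣ t n ∣
      <⟨ ℚ.+-mono-< (h n (ℕ.m⊔n≤o⇒m≤o M N ≤n)) (k n (ℕ.m⊔n≤o⇒n≤o M N ≤n)) ⟩
    ½ ℚ.* ε ℚ.+ ½ ℚ.* ε
      ≡⟨ ½+½ ε ⟩
    ε ∎
  where open ℚ.≤-Reasoning

null-neg : ∀ s → IsNull s → IsNull (λ n → ℚ.- s n)
null-neg s hs ε 0<ε =
  let N , h = hs ε 0<ε
  in N , λ n N≤n → subst (ℚ._< ε) (sym (ℚ.∣-p∣≡∣p∣ (s n))) (h n N≤n)

-- A Cauchy sequence is eventually bounded by some `K`, so it suffices to bring `t` below `δ` with
-- `K δ = ε`.
null-*ˡ : ∀ x t → IsNull t → IsNull (λ n → seq x n ℚ.* t n)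
null-*ˡ x t ht ε 0<ε =
  let K , 0<K , M , b = eventually-bounded {seq x} (cauchy x)
      δ , 0<δ , Kδ≡ε  = divide {K} {ε} 0<K 0<ε
      N , h           = ht δ 0<δ
  in M ⊔ N , λ n ≤n → subst (ℚ.∣ seq x n ℚ.* t n ∣ ℚ.<_) Kδ≡ε
       (∣*∣<* {seq x n} {t n} {K} {δ} 0<K
         (b n (ℕ.m⊔n≤o⇒m≤o M N ≤n)) (h n (ℕ.m⊔n≤o⇒n≤o M N ≤n)))

-- Arithmetic on sequences is termwise, so with this an algebraic identity of rationals becomes one
-- of reals without any estimate.
pointwise : ∀ {x y} → (∀ n → seq x n ≡ seq y n) → x ≈ y
pointwise {x} {y} x≡y = mk≈ (null-resp _ _
  (λ n → sym (trans (cong (ℚ._- seq y n) (x≡y n)) (ℚ.+-inverseʳ (seq y n)))) null-0)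

≈-refl : ∀ {x} → x ≈ x
≈-refl = pointwise λ _ → refl

≈-sym : ∀ {x y} → x ≈ y → y ≈ x
≈-sym {x} {y} x≈y = mk≈ (null-resp _ _
  (λ n → solve 2 (λ a b → :- (a :- b) := b :- a) refl (seq x n) (seq y n))
  (null-neg (λ n → seq x n ℚ.- seq y n) (close x≈y)))

≈-trans : ∀ {x y z} → x ≈ y → y ≈ z → x ≈ z
≈-trans {x} {y} {z} x≈y y≈z = mk≈ (null-resp _ _
  (λ n → solve 3 (λ a b c → (a :- b) :+ (b :- c) := a :- c) refl
           (seq x n) (seq y n) (seq z n))
  (null-+ (λ n → seq x n ℚ.- seq y n) (λ n → seq y n ℚ.- seq z n)
    (close x≈y) (close y≈z)))

+-cong : ∀ {x y u v} → x ≈ y → u ≈ v → x + u ≈ y + v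
+-cong {x} {y} {u} {v} x≈y u≈v = mk≈ (null-resp _ _
  (λ n → solve 4 (λ a b c d → (a :- b) :+ (c :- d) := (a :+ c) :- (b :+ d)) refl
           (seq x n) (seq y n) (seq u n) (seq v n))
  (null-+ (λ n → seq x n ℚ.- seq y n) (λ n → seq u n ℚ.- seq v n)
    (close x≈y) (close u≈v)))

-‿cong : ∀ {x y} → x ≈ y → - x ≈ - y
-‿cong {x} {y} x≈y = mk≈ (null-resp _ _
  (λ n → solve 2 (λ a b → :- (a :- b) := :- a :- :- b) refl (seq x n) (seq y n))
  (null-neg (λ n → seq x n ℚ.- seq y n) (close x≈y)))

*-cong : ∀ {x y u v} → x ≈ y → u ≈ v → x * u ≈ y * v
*-cong {x} {y} {u} {v} x≈y u≈v = mk≈ (null-resp _ _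
  -- The difference of products splits as `x (u - v) + v (x - y)`, a sum of two products of a Cauchy
  -- sequence with a null sequence.
  (λ n → solve 4 (λ a b c d → a :* (c :- d) :+ d :* (a :- b) := a :* c :- b :* d) refl
           (seq x n) (seq y n) (seq u n) (seq v n))
  (null-+ _ _
    (null-*ˡ x (λ n → seq u n ℚ.- seq v n) (close u≈v))
    (null-*ˡ v (λ n → seq x n ℚ.- seq y n) (close x≈y))))

ℝ-commutativeRing : CommutativeRing 0ℓ 0ℓ
ℝ-commutativeRing = record
  { Carrier = ℝ ; _≈_ = _≈_ ; _+_ = _+_ ; _*_ = _*_ ; -_ = -_ ; 0# = 0ℝ ; 1# = fromℚ 1ℚ
  ; isCommutativeRing = record
    { isRing = record
      { +-isAbelianGroup = record
        { isGroup = record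
          { isMonoid = record
            { isSemigroup = record
              { isMagma = record
                { isEquivalence = record { refl = ≈-refl ; sym = ≈-sym ; trans = ≈-trans }
                ; ∙-cong = +-cong
                }
              ; assoc = λ x y z → pointwise λ n → ℚ.+-assoc (seq x n) (seq y n) (seq z n)
              }
            ; identity = (λ x → pointwise λ n → ℚ.+-identityˡ (seq x n))
                       , (λ x → pointwise λ n → ℚ.+-identityʳ (seq x n))
            }
          ; inverse = (λ x → pointwise λ n → ℚ.+-inverseˡ (seq x n))
                    , (λ x → pointwise λ n → ℚ.+-inverseʳ (seq x n))
          ; ⁻¹-cong = -‿cong
          }
        ; comm = λ x y → pointwise λ n → ℚ.+-comm (seq x n) (seq y n)
        }
      ; *-cong = *-cong
      ; *-assoc = λ x y z → pointwise λ n → ℚ.*-assoc (seq x n) (seq y n) (seq z n)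
      ; *-identity = (λ x → pointwise λ n → ℚ.*-identityˡ (seq x n))
                   , (λ x → pointwise λ n → ℚ.*-identityʳ (seq x n))
      ; distrib = (λ x y z → pointwise λ n → ℚ.*-distribˡ-+ (seq x n) (seq y n) (seq z n))
                , (λ x y z → pointwise λ n → ℚ.*-distribʳ-+ (seq x n) (seq y n) (seq z n))
      }
    ; *-comm = λ x y → pointwise λ n → ℚ.*-comm (seq x n) (seq y n)
    }
  }

module ℝR = CommutativeRing ℝ-commutativeRing

-ᶜ_ : ℂ → ℂ
-ᶜ z = (- re z) +i (- im z)

*ᶜ-cong : ∀ {x y u v} → x ≈ᶜ y → u ≈ᶜ v → x *ᶜ u ≈ᶜ y *ᶜ v
*ᶜ-cong (p , q) (r , s) =
    +-cong (*-cong p r) (-‿cong (*-cong q s))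
  , +-cong (*-cong p s) (*-cong q r)

-- The multiplicative laws are polynomial identities in real and imaginary parts, checked by the
-- solver at each index of the rational sequences.
ℂ-commutativeRing : CommutativeRing 0ℓ 0ℓ
ℂ-commutativeRing = record
  { Carrier = ℂ ; _≈_ = _≈ᶜ_ ; _+_ = _+ᶜ_ ; _*_ = _*ᶜ_ ; -_ = -ᶜ_ ; 0# = 0ℂ
  ; 1# = fromℝ (fromℚ 1ℚ)
  ; isCommutativeRing = record
    { isRing = record
      { +-isAbelianGroup = record
        { isGroup = record
          { isMonoid = record
            { isSemigroup = record
              { isMagma = record
                { isEquivalence = record
                  { refl = ≈-refl , ≈-refl
                  ; sym = λ (p , q) → ≈-sym p , ≈-sym q
                  ; trans = λ (p , q) (r , s) → ≈-trans p r , ≈-trans q s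
                  }
                ; ∙-cong = λ (p , q) (r , s) → +-cong p r , +-cong q s
                }
              ; assoc = λ x y z → ℝR.+-assoc (re x) (re y) (re z) , ℝR.+-assoc (im x) (im y) (im z)
              }
            ; identity = (λ x → ℝR.+-identityˡ (re x) , ℝR.+-identityˡ (im x))
                       , (λ x → ℝR.+-identityʳ (re x) , ℝR.+-identityʳ (im x))
            }
          ; inverse = (λ x → ℝR.-‿inverseˡ (re x) , ℝR.-‿inverseˡ (im x))
                    , (λ x → ℝR.-‿inverseʳ (re x) , ℝR.-‿inverseʳ (im x))
          ; ⁻¹-cong = λ (p , q) → -‿cong p , -‿cong q
          }
        ; comm = λ x y → ℝR.+-comm (re x) (re y) , ℝR.+-comm (im x) (im y)
        }
      ; *-cong = *ᶜ-cong
      ; *-assoc = λ x y z →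
          (pointwise λ n → solve 6 (λ a b c d e f →
              (a :* c :- b :* d) :* e :- (a :* d :+ b :* c) :* f
              := a :* (c :* e :- d :* f) :- b :* (c :* f :+ d :* e)) refl
            (seq (re x) n) (seq (im x) n) (seq (re y) n) (seq (im y) n) (seq (re z) n) (seq (im z) n))
        , (pointwise λ n → solve 6 (λ a b c d e f →
              (a :* c :- b :* d) :* f :+ (a :* d :+ b :* c) :* e
              := a :* (c :* f :+ d :* e) :+ b :* (c :* e :- d :* f)) refl
            (seq (re x) n) (seq (im x) n) (seq (re y) n) (seq (im y) n) (seq (re z) n) (seq (im z) n))
      ; *-identity =
          (λ x →
              (pointwise λ n → solve 2 (λ a b → con 1ℚ :* a :- con 0ℚ :* b := a) refl
                (seq (re x) n) (seq (im x) n))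
            , (pointwise λ n → solve 2 (λ a b → con 1ℚ :* b :+ con 0ℚ :* a := b) refl
                (seq (re x) n) (seq (im x) n)))
        , (λ x →
              (pointwise λ n → solve 2 (λ a b → a :* con 1ℚ :- b :* con 0ℚ := a) refl
                (seq (re x) n) (seq (im x) n))
            , (pointwise λ n → solve 2 (λ a b → a :* con 0ℚ :+ b :* con 1ℚ := b) refl
                (seq (re x) n) (seq (im x) n)))
      ; distrib =
          (λ x y z →
              (pointwise λ n → solve 6 (λ a b c d e f →
                  a :* (c :+ e) :- b :* (d :+ f)
                  := (a :* c :- b :* d) :+ (a :* e :- b :* f)) refl
                (seq (re x) n) (seq (im x) n) (seq (re y) n) (seq (im y) n) (seq (re z) n) (seq (im z) n))
            , (pointwise λ n → solve 6 (λ a b c d e f →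
                  a :* (d :+ f) :+ b :* (c :+ e)
                  := (a :* d :+ b :* c) :+ (a :* f :+ b :* e)) refl
                (seq (re x) n) (seq (im x) n) (seq (re y) n) (seq (im y) n) (seq (re z) n) (seq (im z) n)))
        , (λ x y z →
              (pointwise λ n → solve 6 (λ a b c d e f →
                  (c :+ e) :* a :- (d :+ f) :* b
                  := (c :* a :- d :* b) :+ (e :* a :- f :* b)) refl
                (seq (re x) n) (seq (im x) n) (seq (re y) n) (seq (im y) n) (seq (re z) n) (seq (im z) n))
            , (pointwise λ n → solve 6 (λ a b c d e f →
                  (c :+ e) :* b :+ (d :+ f) :* a
                  := (c :* b :+ d :* a) :+ (e :* b :+ f :* a)) refl
                (seq (re x) n) (seq (im x) n) (seq (re y) n) (seq (im y) n) (seq (re z) n) (seq (im z) n)))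
      }
    ; *-comm = λ x y →
        (pointwise λ n → solve 4 (λ a b c d → a :* c :- b :* d := c :* a :- d :* b) refl
          (seq (re x) n) (seq (im x) n) (seq (re y) n) (seq (im y) n))
      , (pointwise λ n → solve 4 (λ a b c d → a :* d :+ b :* c := c :* b :+ d :* a) refl
          (seq (re x) n) (seq (im x) n) (seq (re y) n) (seq (im y) n))
    }
  }

module ℂR = CommutativeRing ℂ-commutativeRing

import Algebra.Properties.Group ℝR.+-group as ℝGroup
import Algebra.Properties.Semiring.Sum ℝR.semiring as ℝSum
import Algebra.Properties.Group ℂR.+-group as ℂGroup
import Algebra.Properties.Ring ℂR.ring as ℂRing
import Algebra.Properties.Semiring.Sum ℂR.semiring as ℂSum

-- Apartness, stability and order

-- The positive form of being nonzero: a rational `δ` bounds the tail away from zero. Unlike a bare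
-- negation, it carries a bound that can be multiplied.
Apart : ℝ → Set
Apart x = ∃ λ δ → 0ℚ ℚ.< δ × ∃ λ N → ∀ n → N ℕ.≤ n → δ ℚ.≤ ℚ.∣ seq x n ∣

∣p∣≤∣p-q∣+∣q∣ : ∀ p q → ℚ.∣ p ∣ ℚ.≤ ℚ.∣ p ℚ.- q ∣ ℚ.+ ℚ.∣ q ∣
∣p∣≤∣p-q∣+∣q∣ p q = subst (λ r → ℚ.∣ r ∣ ℚ.≤ ℚ.∣ p ℚ.- q ∣ ℚ.+ ℚ.∣ q ∣)
  (solve 2 (λ a b → (a :- b) :+ b := a) refl p q) (ℚ.∣p+q∣≤∣p∣+∣q∣ (p ℚ.- q) q)

apart⇒≉0 : ∀ {x} → Apart x → ¬ (x ≈ 0ℝ)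
apart⇒≉0 {x} (δ , 0<δ , M , far) x≈0 =
  let N , near = close x≈0 δ 0<δ
      n        = M ⊔ N
  in ℚ.<-irrefl refl (begin-strict
    δ                        ≤⟨ far n (ℕ.m≤m⊔n M N) ⟩
    ℚ.∣ seq x n ∣            ≡⟨ cong ℚ.∣_∣ (ℚ.+-identityʳ (seq x n)) ⟨
    ℚ.∣ seq x n ℚ.- 0ℚ ∣     <⟨ near n (ℕ.m≤n⊔m M N) ⟩
    δ                        ∎)
  where open ℚ.≤-Reasoning

-- Constructively valid because the Cauchy modulus makes "∣ x N ∣ < ½ ε" a
-- decision about x itself: either answer holds, up to ¼ ε, for the whole tail.
¬apart⇒≈0 : ∀ {x} → ¬ Apart x → x ≈ 0ℝ
¬apart⇒≈0 {x} ¬apart = mk≈ near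
  where
  open ℚ.≤-Reasoning
  near : IsNull (λ n → seq x n ℚ.- 0ℚ)
  near ε 0<ε with cauchy x (½ ℚ.* (½ ℚ.* ε)) (0<½* (0<½* 0<ε))
  ... | N , h with ℚ.∣ seq x N ∣ ℚ.<? ½ ℚ.* ε
  ...   | yes xN<½ε = N , λ n N≤n → begin-strict
    ℚ.∣ seq x n ℚ.- 0ℚ ∣
      ≡⟨ cong ℚ.∣_∣ (ℚ.+-identityʳ (seq x n)) ⟩
    ℚ.∣ seq x n ∣
      ≤⟨ ∣p∣≤∣p-q∣+∣q∣ (seq x n) (seq x N) ⟩
    ℚ.∣ seq x n ℚ.- seq x N ∣ ℚ.+ ℚ.∣ seq x N ∣
      <⟨ ℚ.+-mono-< (h n N N≤n ℕ.≤-refl) xN<½ε ⟩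
    ½ ℚ.* (½ ℚ.* ε) ℚ.+ ½ ℚ.* ε
      ≡⟨ ℚ.+-identityʳ _ ⟨
    ½ ℚ.* (½ ℚ.* ε) ℚ.+ ½ ℚ.* ε ℚ.+ 0ℚ
      ≤⟨ ℚ.+-monoʳ-≤ (½ ℚ.* (½ ℚ.* ε) ℚ.+ ½ ℚ.* ε) (ℚ.<⇒≤ (0<½* (0<½* 0<ε))) ⟩
    ½ ℚ.* (½ ℚ.* ε) ℚ.+ ½ ℚ.* ε ℚ.+ ½ ℚ.* (½ ℚ.* ε)
      ≡⟨ solve 1 (λ e → con ½ :* (con ½ :* e) :+ con ½ :* e :+ con ½ :* (con ½ :* e) := e) refl ε ⟩
    ε ∎
  ...   | no xN≮½ε = contradiction
    ( ½ ℚ.* (½ ℚ.* ε) , 0<½* (0<½* 0<ε) , N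
    , λ n N≤n → ℚ.≮⇒≥ λ xn<¼ε → xN≮½ε (begin-strict
        ℚ.∣ seq x N ∣
          ≤⟨ ∣p∣≤∣p-q∣+∣q∣ (seq x N) (seq x n) ⟩
        ℚ.∣ seq x N ℚ.- seq x n ∣ ℚ.+ ℚ.∣ seq x n ∣
          <⟨ ℚ.+-mono-< (h N n ℕ.≤-refl N≤n) xn<¼ε ⟩
        ½ ℚ.* (½ ℚ.* ε) ℚ.+ ½ ℚ.* (½ ℚ.* ε)
          ≡⟨ ½+½ (½ ℚ.* ε) ⟩
        ½ ℚ.* ε ∎)
    ) ¬apart

-- Equality amounts to the negation of `Apart (x - y)`, and a negation is stable under double
-- negation. This permits classical case splits while proving an equality.
≈-stable : ∀ {x y} → ¬ ¬ (x ≈ y) → x ≈ y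
≈-stable {x} {y} ¬¬x≈y = ℝGroup.x∙y⁻¹≈ε⇒x≈y x y (¬apart⇒≈0 λ apart →
  ¬¬x≈y λ x≈y → apart⇒≉0 apart (ℝGroup.x≈y⇒x∙y⁻¹≈ε x≈y))

-- Cancellation of nonzero real and complex factors.

*-mono-≤ : ∀ {p q r s} → 0ℚ ℚ.≤ q → 0ℚ ℚ.≤ r → p ℚ.≤ q → r ℚ.≤ s → p ℚ.* r ℚ.≤ q ℚ.* s
*-mono-≤ {p} {q} {r} {s} 0≤q 0≤r p≤q r≤s = ℚ.≤-trans
  (ℚ.*-monoʳ-≤-nonNeg r {{ℚ.nonNegative 0≤r}} p≤q)
  (ℚ.*-monoˡ-≤-nonNeg q {{ℚ.nonNegative 0≤q}} r≤s)

0<* : ∀ {p q} → 0ℚ ℚ.< p → 0ℚ ℚ.< q → 0ℚ ℚ.< p ℚ.* q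
0<* {p} {q} 0<p 0<q = ℚ.positive⁻¹ (p ℚ.* q)
  {{ℚ.pos*pos⇒pos p {{ℚ.positive 0<p}} q {{ℚ.positive 0<q}}}}

apart-* : ∀ {x y} → Apart x → Apart y → Apart (x * y)
apart-* {x} {y} (δ , 0<δ , M , hx) (η , 0<η , N , hy) =
  δ ℚ.* η , 0<* 0<δ 0<η , M ⊔ N , λ n ≤n →
    subst (δ ℚ.* η ℚ.≤_) (sym (ℚ.∣p*q∣≡∣p∣*∣q∣ (seq x n) (seq y n)))
      (*-mono-≤ (ℚ.0≤∣p∣ (seq x n)) (ℚ.<⇒≤ 0<η)
        (hx n (ℕ.m⊔n≤o⇒m≤o M N ≤n)) (hy n (ℕ.m⊔n≤o⇒n≤o M N ≤n)))

-- Were `y` apart from zero, `x` could not be, since the product would then be apart from zero; but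
-- then `x ≈ 0ℝ`, which is excluded.
x*y≈0∧x≉0⇒y≈0 : ∀ {x y} → x * y ≈ 0ℝ → ¬ (x ≈ 0ℝ) → y ≈ 0ℝ
x*y≈0∧x≉0⇒y≈0 {x} {y} xy≈0 x≉0 = ¬apart⇒≈0 λ apart-y →
  x≉0 (¬apart⇒≈0 λ apart-x → apart⇒≉0 (apart-* {x} {y} apart-x apart-y) xy≈0)

x*x≈0⇒x≈0 : ∀ {x} → x * x ≈ 0ℝ → x ≈ 0ℝ
x*x≈0⇒x≈0 xx≈0 = ≈-stable λ x≉0 → x≉0 (x*y≈0∧x≉0⇒y≈0 xx≈0 x≉0)

0≤p*p : ∀ p → 0ℚ ℚ.≤ p ℚ.* p
0≤p*p p = subst (0ℚ ℚ.≤_) (square p) (ℚ.0≤∣p∣ (p ℚ.* p))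
  where
  square : ∀ p → ℚ.∣ p ℚ.* p ∣ ≡ p ℚ.* p
  square p with ℚ.∣p∣≡p∨∣p∣≡-p p
  ... | inj₁ ∣p∣≡p  = trans (ℚ.∣p*q∣≡∣p∣*∣q∣ p p) (cong₂ ℚ._*_ ∣p∣≡p ∣p∣≡p)
  ... | inj₂ ∣p∣≡-p = trans (ℚ.∣p*q∣≡∣p∣*∣q∣ p p) (trans (cong₂ ℚ._*_ ∣p∣≡-p ∣p∣≡-p)
    (solve 1 (λ a → :- a :* :- a := a :* a) refl p))

∣p∣≤∣p+q∣ : ∀ {p q} → 0ℚ ℚ.≤ p → 0ℚ ℚ.≤ q → ℚ.∣ p ∣ ℚ.≤ ℚ.∣ p ℚ.+ q ∣
∣p∣≤∣p+q∣ {p} {q} 0≤p 0≤q = begin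
  ℚ.∣ p ∣          ≡⟨ ℚ.0≤p⇒∣p∣≡p 0≤p ⟩
  p                ≡⟨ ℚ.+-identityʳ p ⟨
  p ℚ.+ 0ℚ         ≤⟨ ℚ.+-monoʳ-≤ p 0≤q ⟩
  p ℚ.+ q          ≡⟨ ℚ.0≤p⇒∣p∣≡p (ℚ.+-mono-≤ 0≤p 0≤q) ⟨
  ℚ.∣ p ℚ.+ q ∣    ∎
  where open ℚ.≤-Reasoning

-- Squares are nonnegative at every index, so the terms of `x * x` are dominated by those of the
-- null sum.
x²+y²≈0⇒x≈0 : ∀ {x y} → x * x + y * y ≈ 0ℝ → x ≈ 0ℝ
x²+y²≈0⇒x≈0 {x} {y} x²+y²≈0 = x*x≈0⇒x≈0 (mk≈ λ ε 0<ε →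
  let N , h = close x²+y²≈0 ε 0<ε
  in N , λ n N≤n → begin-strict
    ℚ.∣ seq (x * x) n ℚ.- 0ℚ ∣
      ≡⟨ cong ℚ.∣_∣ (ℚ.+-identityʳ (seq (x * x) n)) ⟩
    ℚ.∣ seq (x * x) n ∣
      ≤⟨ ∣p∣≤∣p+q∣ (0≤p*p (seq x n)) (0≤p*p (seq y n)) ⟩
    ℚ.∣ seq (x * x + y * y) n ∣
      ≡⟨ cong ℚ.∣_∣ (ℚ.+-identityʳ (seq (x * x + y * y) n)) ⟨
    ℚ.∣ seq (x * x + y * y) n ℚ.- 0ℚ ∣
      <⟨ h n N≤n ⟩
    ε ∎)
  where open ℚ.≤-Reasoning

-- Multiplying z w by the conjugate of z reduces this to the real factor ∣z∣².
z*w≈0∧z≉0⇒w≈0 : ∀ {z w} → z *ᶜ w ≈ᶜ 0ℂ → ¬ (z ≈ᶜ 0ℂ) → w ≈ᶜ 0ℂ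
z*w≈0∧z≉0⇒w≈0 {z} {w} (r≈0 , i≈0) z≉0 =
    x*y≈0∧x≉0⇒y≈0 (ℝR.trans
      (pointwise λ n → solve 4 (λ a b c d →
          (a :* a :+ b :* b) :* c
          := a :* (a :* c :- b :* d) :+ b :* (a :* d :+ b :* c)) refl
        (seq (re z) n) (seq (im z) n) (seq (re w) n) (seq (im w) n))
      (combination≈0 (re z) (im z) r≈0 i≈0)) ∣z∣²≉0
  , x*y≈0∧x≉0⇒y≈0 (ℝR.trans
      (pointwise λ n → solve 4 (λ a b c d →
          (a :* a :+ b :* b) :* d
          := a :* (a :* d :+ b :* c) :+ :- b :* (a :* c :- b :* d)) refl
        (seq (re z) n) (seq (im z) n) (seq (re w) n) (seq (im w) n))
      (combination≈0 (re z) (- im z) i≈0 r≈0)) ∣z∣²≉0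
  where
  combination≈0 : ∀ x y {u v} → u ≈ 0ℝ → v ≈ 0ℝ → x * u + y * v ≈ 0ℝ
  combination≈0 x y u≈0 v≈0 = ℝR.trans
    (ℝR.+-cong (ℝR.trans (ℝR.*-congˡ u≈0) (ℝR.zeroʳ x)) (ℝR.trans (ℝR.*-congˡ v≈0) (ℝR.zeroʳ y)))
    (ℝR.+-identityˡ 0ℝ)
  ∣z∣²≉0 : ¬ (re z * re z + im z * im z ≈ 0ℝ)
  ∣z∣²≉0 ∣z∣²≈0 = z≉0
    (x²+y²≈0⇒x≈0 ∣z∣²≈0 , x²+y²≈0⇒x≈0 (ℝR.trans (ℝR.+-comm _ _) ∣z∣²≈0))

-- The order on the reals.

p≤∣p∣ : ∀ p → p ℚ.≤ ℚ.∣ p ∣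
p≤∣p∣ p = ℚ.≮⇒≥ λ ∣p∣<p → ℚ.<-irrefl
  (ℚ.0≤p⇒∣p∣≡p (ℚ.<⇒≤ (ℚ.≤-<-trans (ℚ.0≤∣p∣ p) ∣p∣<p))) ∣p∣<p

≈⇒≤ : ∀ {x y} → x ≈ y → x ≤ y
≈⇒≤ {x} {y} x≈y = mk≤ λ ε 0<ε →
  let N , h = close x≈y ε 0<ε
  in N , λ n N≤n → begin-strict
    seq x n                               ≡⟨ solve 2 (λ a b → a := b :+ (a :- b)) refl (seq x n) (seq y n) ⟩
    seq y n ℚ.+ (seq x n ℚ.- seq y n)     ≤⟨ ℚ.+-monoʳ-≤ (seq y n) (p≤∣p∣ _) ⟩
    seq y n ℚ.+ ℚ.∣ seq x n ℚ.- seq y n ∣ <⟨ ℚ.+-monoʳ-< (seq y n) (h n N≤n) ⟩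
    seq y n ℚ.+ ε                         ∎
  where open ℚ.≤-Reasoning

≤-trans : ∀ {x y z} → x ≤ y → y ≤ z → x ≤ z
≤-trans {x} {y} {z} x≤y y≤z = mk≤ λ ε 0<ε →
  let M , h = below x≤y (½ ℚ.* ε) (0<½* 0<ε)
      N , k = below y≤z (½ ℚ.* ε) (0<½* 0<ε)
  in M ⊔ N , λ n ≤n → begin-strict
    seq x n                                 <⟨ h n (ℕ.m⊔n≤o⇒m≤o M N ≤n) ⟩
    seq y n ℚ.+ ½ ℚ.* ε                     <⟨ ℚ.+-monoˡ-< (½ ℚ.* ε) (k n (ℕ.m⊔n≤o⇒n≤o M N ≤n)) ⟩
    seq z n ℚ.+ ½ ℚ.* ε ℚ.+ ½ ℚ.* ε         ≡⟨ ℚ.+-assoc (seq z n) (½ ℚ.* ε) (½ ℚ.* ε) ⟩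
    seq z n ℚ.+ (½ ℚ.* ε ℚ.+ ½ ℚ.* ε)       ≡⟨ cong (seq z n ℚ.+_) (½+½ ε) ⟩
    seq z n ℚ.+ ε                           ∎
  where open ℚ.≤-Reasoning

p<q+ε⇒p-q<ε : ∀ p q {ε} → p ℚ.< q ℚ.+ ε → p ℚ.- q ℚ.< ε
p<q+ε⇒p-q<ε p q {ε} p<q+ε = subst (p ℚ.- q ℚ.<_)
  (solve 2 (λ b e → b :+ e :- b := e) refl q ε) (ℚ.+-monoˡ-< (ℚ.- q) p<q+ε)

≤-antisym : ∀ {x y} → x ≤ y → y ≤ x → x ≈ y
≤-antisym {x} {y} x≤y y≤x = mk≈ λ ε 0<ε →
  let M , h = below x≤y ε 0<ε
      N , k = below y≤x ε 0<ε
  in M ⊔ N , λ n ≤n → ∣∣< n (h n (ℕ.m⊔n≤o⇒m≤o M N ≤n)) (k n (ℕ.m⊔n≤o⇒n≤o M N ≤n))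
  where
  ∣∣< : ∀ n {ε} → seq x n ℚ.< seq y n ℚ.+ ε → seq y n ℚ.< seq x n ℚ.+ ε →
        ℚ.∣ seq x n ℚ.- seq y n ∣ ℚ.< ε
  ∣∣< n {ε} x<y+ε y<x+ε with ℚ.∣p∣≡p∨∣p∣≡-p (seq x n ℚ.- seq y n)
  ... | inj₁ e = subst (ℚ._< ε) (sym e) (p<q+ε⇒p-q<ε (seq x n) (seq y n) x<y+ε)
  ... | inj₂ e = subst (ℚ._< ε)
    (trans (solve 2 (λ a b → b :- a := :- (a :- b)) refl (seq x n) (seq y n)) (sym e))
    (p<q+ε⇒p-q<ε (seq y n) (seq x n) y<x+ε)

-- Partitions and eigenvalues

-- The induction step for counting a subset. Since `ℚ._/_` normalises by a gcd, the equation is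
-- checked on unnormalised fractions.
suc/1 : ∀ m → + suc m ℚ./ 1 ≡ 1ℚ ℚ.+ + m ℚ./ 1
suc/1 m = ℚ.toℚᵘ-injective (begin-equality
  ℚ.toℚᵘ (+ suc m ℚ./ 1)              ≃⟨ ℚ.toℚᵘ-fromℚᵘ (ℚᵘ.mkℚᵘ (+ suc m) 0) ⟩
  ℚᵘ.mkℚᵘ (+ suc m) 0                 ≃⟨ ℚᵘ.*≡* (cong (λ k → (+ 1 ℤ.+ k) ℤ.* + 1) (sym (ℤ.*-identityʳ (+ m)))) ⟩
  ℚᵘ.1ℚᵘ ℚᵘ.+ ℚᵘ.mkℚᵘ (+ m) 0         ≃⟨ ℚᵘ.+-congʳ ℚᵘ.1ℚᵘ (ℚ.toℚᵘ-fromℚᵘ (ℚᵘ.mkℚᵘ (+ m) 0)) ⟨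
  ℚᵘ.1ℚᵘ ℚᵘ.+ ℚ.toℚᵘ (+ m ℚ./ 1)      ≃⟨ ℚ.toℚᵘ-homo-+ 1ℚ (+ m ℚ./ 1) ⟨
  ℚ.toℚᵘ (1ℚ ℚ.+ + m ℚ./ 1)           ∎)
  where open ℚᵘ.≤-Reasoning

1/m*m/1≡1 : ∀ m .{{_ : ℕ.NonZero m}} → (+ 1 ℚ./ m) ℚ.* (+ m ℚ./ 1) ≡ 1ℚ
1/m*m/1≡1 (suc k) = ℚ.toℚᵘ-injective (begin-equality
  ℚ.toℚᵘ ((+ 1 ℚ./ suc k) ℚ.* (+ suc k ℚ./ 1))
    ≃⟨ ℚ.toℚᵘ-homo-* (+ 1 ℚ./ suc k) (+ suc k ℚ./ 1) ⟩
  ℚ.toℚᵘ (+ 1 ℚ./ suc k) ℚᵘ.* ℚ.toℚᵘ (+ suc k ℚ./ 1)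
    ≃⟨ ℚᵘ.*-cong (ℚ.toℚᵘ-fromℚᵘ (ℚᵘ.mkℚᵘ (+ 1) k)) (ℚ.toℚᵘ-fromℚᵘ (ℚᵘ.mkℚᵘ (+ suc k) 0)) ⟩
  ℚᵘ.mkℚᵘ (+ 1) k ℚᵘ.* ℚᵘ.mkℚᵘ (+ suc k) 0
    ≃⟨ ℚᵘ.*≡* (ℤ.*-assoc (+ 1) (+ suc k) (+ 1)) ⟩
  ℚᵘ.1ℚᵘ ∎)
  where open ℚᵘ.≤-Reasoning

∑∈-cong : ∀ {n} (p : Subset n) {f g : Vector ℝ n} →
          (∀ i → i ∈ p → f i ≈ g i) → ∑∈ p f ≈ ∑∈ p g
∑∈-cong p {f} {g} f≈g = ℝSum.sum-cong-≋ λ i → summand i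
  where
  summand : ∀ i → (if does (i ∈? p) then f i else 0ℝ) ≈ (if does (i ∈? p) then g i else 0ℝ)
  summand i with i ∈? p
  ... | yes i∈p = f≈g i i∈p
  ... | no  _   = ℝR.refl

∑∈-const : ∀ {n} (p : Subset n) x → ∑∈ p (λ _ → x) ≈ fromℚ (+ ∣ p ∣ ℚ./ 1) * x
∑∈-const []            x = ℝR.sym (ℝR.zeroˡ x)
∑∈-const (outside ∷ p) x = ℝR.trans (ℝR.+-identityˡ _) (∑∈-const p x)
∑∈-const (inside  ∷ p) x = begin
  x + ∑∈ p (λ _ → x)                        ≈⟨ ℝR.+-congˡ (∑∈-const p x) ⟩
  x + fromℚ (+ ∣ p ∣ ℚ./ 1) * x             ≈⟨ ℝR.+-congʳ (ℝR.*-identityˡ x) ⟨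
  fromℚ 1ℚ * x + fromℚ (+ ∣ p ∣ ℚ./ 1) * x  ≈⟨ pointwise (λ n → ℚ.*-distribʳ-+ (seq x n) 1ℚ (+ ∣ p ∣ ℚ./ 1)) ⟨
  fromℚ (1ℚ ℚ.+ + ∣ p ∣ ℚ./ 1) * x          ≡⟨ cong (λ q → fromℚ q * x) (suc/1 ∣ p ∣) ⟨
  fromℚ (+ suc ∣ p ∣ ℚ./ 1) * x             ∎
  where open SetoidReasoning ℝR.setoid

-- The sum is `∣ p ∣` copies of `x`, and the prefactor cancels the count. Applied to row sums, this
-- turns the average defining a quotient entry into the sum of a single row.
average-const : ∀ {n} (p : Subset n) .{{_ : ℕ.NonZero ∣ p ∣}} {f : Vector ℝ n} {x} →
                (∀ i → i ∈ p → f i ≈ x) → fromℚ (+ 1 ℚ./ ∣ p ∣) * ∑∈ p f ≈ x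
average-const p {f} {x} f≈x = begin
  fromℚ (+ 1 ℚ./ ∣ p ∣) * ∑∈ p f                        ≈⟨ ℝR.*-congˡ (∑∈-cong p f≈x) ⟩
  fromℚ (+ 1 ℚ./ ∣ p ∣) * ∑∈ p (λ _ → x)                ≈⟨ ℝR.*-congˡ (∑∈-const p x) ⟩
  fromℚ (+ 1 ℚ./ ∣ p ∣) * (fromℚ (+ ∣ p ∣ ℚ./ 1) * x)   ≈⟨ pointwise (λ n → ℚ.*-assoc (+ 1 ℚ./ ∣ p ∣) (+ ∣ p ∣ ℚ./ 1) (seq x n)) ⟨
  fromℚ ((+ 1 ℚ./ ∣ p ∣) ℚ.* (+ ∣ p ∣ ℚ./ 1)) * x       ≡⟨ cong (λ q → fromℚ q * x) (1/m*m/1≡1 ∣ p ∣) ⟩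
  fromℚ 1ℚ * x                                          ≈⟨ ℝR.*-identityˡ x ⟩
  x                                                     ∎
  where open SetoidReasoning ℝR.setoid

fromℝ-cong : ∀ {x y} → x ≈ y → fromℝ x ≈ᶜ fromℝ y
fromℝ-cong x≈y = x≈y , ℝR.refl

fromℝ-sum : ∀ {n} (f : Vector ℝ n) → fromℝ (sumℝ f) ≈ᶜ sumℂ (fromℝ ∘ f)
fromℝ-sum {ℕ.zero} f = ℂR.refl
fromℝ-sum {suc n}  f = ℂR.trans
  -- Real parts agree on the nose; the imaginary parts are `0ℝ` and `0ℝ + 0ℝ`.
  (ℝR.refl , ℝR.sym (ℝR.+-identityˡ 0ℝ)) (ℂR.+-congˡ {fromℝ (f zero)} (fromℝ-sum (f ∘ suc)))

sumℂ-single : ∀ {n} (f : Vector ℂ n) a → (∀ b → ¬ a ≡ b → f b ≈ᶜ 0ℂ) → sumℂ f ≈ᶜ f a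
sumℂ-single {suc n} f zero    f≈0 = ℂR.trans
  (ℂR.+-congˡ (ℂR.trans (ℂSum.sum-cong-≋ λ b → f≈0 (suc b) λ ()) (ℂSum.sum-replicate-zero n)))
  (ℂR.+-identityʳ (f zero))
sumℂ-single {suc n} f (suc a) f≈0 = ℂR.trans
  (ℂR.+-cong (f≈0 zero λ ()) (sumℂ-single (f ∘ suc) a λ b a≢b → f≈0 (suc b) λ { refl → a≢b refl }))
  (ℂR.+-identityˡ (f (suc a)))

-- The intertwining relation and the transfer of eigenvectors.

infixr 8 _·_

-- The equation inside `IsEigenvalue` is definitionally `(A · v) i ≈ᶜ z *ᶜ v i`.
_·_ : ∀ {n} → Matrix n → Vector ℂ n → Vector ℂ n
(A · v) i = sumℂ (λ j → fromℝ (A i j) *ᶜ v j)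

module _ {n ℓ} (π : Fin ℓ → Subset n) (part : IsPartition π) (C : Matrix n)
         (rows≈ : ∀ a i k → i ∈ π a → k ∈ π a → ∀ j → C i j ≈ C k j) where

  open IsPartition part

  Q : Matrix ℓ
  Q = quotient π part C

  -- All rows in `π a` have the same sum over `π b`, so their average is the sum of any one of them.
  -- Entrywise this is the intertwining relation.
  quotient≈∑∈ : ∀ {a i} → i ∈ π a → ∀ b → Q a b ≈ ∑∈ (π b) (C i)
  quotient≈∑∈ {a} {i} i∈a b =
    average-const (π a) {{nonempty⇒∣p∣≢0 (nonempty a)}}
      λ k k∈a → ∑∈-cong (π b) λ j _ → rows≈ a k i k∈a i∈a j

  -- Exactly one part contains `j`: `cover` provides it, and `disjoint` makes every other term
  -- vanish.
  sum-over-parts : ∀ j z (w : Vector ℂ ℓ) →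
    (∀ b → j ∈ π b → w b ≈ᶜ z) → ∀ x →
    sumℂ (λ b → fromℝ (if does (j ∈? π b) then x else 0ℝ) *ᶜ w b) ≈ᶜ fromℝ x *ᶜ z
  sum-over-parts j z w w≈z x with cover j
  ... | a , j∈a = ℂR.trans
    (sumℂ-single summand a other) same
    where
    summand : Vector ℂ ℓ
    summand b = fromℝ (if does (j ∈? π b) then x else 0ℝ) *ᶜ w b
    same : summand a ≈ᶜ fromℝ x *ᶜ z
    same rewrite dec-true (j ∈? π a) j∈a = ℂR.*-congˡ {fromℝ x} (w≈z a j∈a)
    other : ∀ b → ¬ a ≡ b → summand b ≈ᶜ 0ℂ
    other b a≢b rewrite dec-false (j ∈? π b) (a≢b ∘ disjoint j∈a) = ℂR.zeroˡ (w b)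

  -- With `S` the incidence matrix, the hypothesis reads `v = S w` and the conclusion
  -- `S (Q w) = C v`. Both directions of the eigenvalue correspondence rest on it.
  quotient-intertwines : ∀ {v : Vector ℂ n} {w : Vector ℂ ℓ} →
    (∀ {i a} → i ∈ π a → v i ≈ᶜ w a) →
    ∀ {i a} → i ∈ π a → (Q · w) a ≈ᶜ (C · v) i
  quotient-intertwines {v} {w} v≈w {i} {a} i∈a = begin
    sumℂ (λ b → fromℝ (Q a b) *ᶜ w b)
      ≈⟨ ℂSum.sum-cong-≋ (λ b → ℂR.*-congʳ {w b} (ℂR.trans (fromℝ-cong (quotient≈∑∈ i∈a b)) (fromℝ-sum (entry b)))) ⟩
    sumℂ (λ b → sumℂ (λ j → fromℝ (entry b j)) *ᶜ w b)
      ≈⟨ ℂSum.sum-cong-≋ (λ b → ℂSum.*-distribʳ-sum (w b) (fromℝ ∘ entry b)) ⟩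
    sumℂ (λ b → sumℂ (λ j → fromℝ (entry b j) *ᶜ w b))
      -- Once the sums are exchanged, the inner sum for a fixed column `j` runs over the parts, and
      -- only the part of `j` contributes.
      ≈⟨ ℂSum.∑-comm (λ b j → fromℝ (entry b j) *ᶜ w b) ⟩
    sumℂ (λ j → sumℂ (λ b → fromℝ (entry b j) *ᶜ w b))
      ≈⟨ ℂSum.sum-cong-≋ (λ j → sum-over-parts j (v j) w (λ b j∈b → ℂR.sym (v≈w j∈b)) (C i j)) ⟩
    sumℂ (λ j → fromℝ (C i j) *ᶜ v j) ∎
    where
    open SetoidReasoning ℂR.setoid
    entry : Fin ℓ → Vector ℝ n
    entry b j = if does (j ∈? π b) then C i j else 0ℝ

  -- Rows `i` and `k` of `C` agree, so `z *ᶜ v i ≈ᶜ z *ᶜ v k`, and the nonzero factor `z` cancels.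
  eigenvector-constant : ∀ {z v} → ¬ (z ≈ᶜ 0ℂ) → (∀ i → (C · v) i ≈ᶜ z *ᶜ v i) →
    ∀ {i k a} → i ∈ π a → k ∈ π a → v i ≈ᶜ v k
  eigenvector-constant {z} {v} z≉0 Cv≈zv {i} {k} {a} i∈a k∈a =
    ℂGroup.x∙y⁻¹≈ε⇒x≈y (v i) (v k) (z*w≈0∧z≉0⇒w≈0 (begin
      z *ᶜ (v i +ᶜ -ᶜ v k)            ≈⟨ ℂRing.x[y-z]≈xy-xz z (v i) (v k) ⟩
      z *ᶜ v i +ᶜ -ᶜ (z *ᶜ v k)       ≈⟨ ℂGroup.x≈y⇒x∙y⁻¹≈ε zvᵢ≈zvₖ ⟩
      0ℂ                              ∎) z≉0)
    where
    open SetoidReasoning ℂR.setoid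
    zvᵢ≈zvₖ : z *ᶜ v i ≈ᶜ z *ᶜ v k
    zvᵢ≈zvₖ = begin
      z *ᶜ v i    ≈⟨ Cv≈zv i ⟨
      (C · v) i   ≈⟨ ℂSum.sum-cong-≋ (λ j → ℂR.*-congʳ {v j} (fromℝ-cong (rows≈ a i k i∈a k∈a j))) ⟩
      (C · v) k   ≈⟨ Cv≈zv k ⟩
      z *ᶜ v k    ∎

  eigenvalue-quotient : ∀ z → ¬ (z ≈ᶜ 0ℂ) → IsEigenvalue C z → IsEigenvalue Q z
  eigenvalue-quotient z z≉0 (v , v≉0 , Cv≈zv) =
    -- The eigenvector equation at `a` is read off at the representative of `π a`, where `v` equals
    -- `w a` by definition.
    w , w≉0 , λ a → ℂR.trans
      (quotient-intertwines {v} {w} v≈w (proj₂ (nonempty a))) (Cv≈zv (proj₁ (nonempty a)))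
    where
    w : Vector ℂ ℓ
    w a = v (proj₁ (nonempty a))
    v≈w : ∀ {i a} → i ∈ π a → v i ≈ᶜ w a
    v≈w {i} {a} i∈a = eigenvector-constant {z} {v} z≉0 Cv≈zv i∈a (proj₂ (nonempty a))
    w≉0 : ¬ (∀ a → w a ≈ᶜ 0ℂ)
    -- Every index lies in some part, so `v` would vanish together with its values on
    -- representatives.
    w≉0 w≈0 = v≉0 λ i → let a , i∈a = cover i in ℂR.trans (v≈w i∈a) (w≈0 a)

  eigenvalue-lift : ∀ z → IsEigenvalue Q z → IsEigenvalue C z
  eigenvalue-lift z (w , w≉0 , Qw≈zw) =
    v , v≉0 , λ i → let a , i∈a = cover i in
      ℂR.trans (ℂR.sym (quotient-intertwines {v} {w} v≈w i∈a)) (Qw≈zw a)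
    where
    v : Vector ℂ n
    v i = w (proj₁ (cover i))
    v≈w : ∀ {i a} → i ∈ π a → v i ≈ᶜ w a
    -- The part picked by `cover i` must be `a`, by disjointness.
    v≈w {i} i∈a = ℂR.reflexive (cong w (disjoint (proj₂ (cover i)) i∈a))
    v≉0 : ¬ (∀ i → v i ≈ᶜ 0ℂ)
    -- Every part has a member, so each entry of `w` occurs as an entry of `v`.
    v≉0 v≈0 = w≉0 λ a → let i , i∈a = nonempty a in ℂR.trans (ℂR.sym (v≈w i∈a)) (v≈0 i)

-- Comparison of spectral radii.

modulus-0 : ∀ {z r} → z ≈ᶜ 0ℂ → IsModulus z r → r ≈ 0ℝ
modulus-0 {z} {r} (re≈0 , im≈0) (_ , r²≈) = x*x≈0⇒x≈0 (begin
  r * r                        ≈⟨ r²≈ ⟩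
  re z * re z + im z * im z    ≈⟨ ℝR.+-cong (ℝR.*-cong re≈0 re≈0) (ℝR.*-cong im≈0 im≈0) ⟩
  0ℝ * 0ℝ + 0ℝ * 0ℝ            ≈⟨ pointwise (λ _ → refl) ⟩
  0ℝ                           ∎)
  where open SetoidReasoning ℝR.setoid

-- Whether the eigenvalue `z` attaining `r` is zero cannot be decided, hence the double negation. If
-- `r ≤ s` is refuted, then `z` is nonzero, so it is an eigenvalue of `B` and maximality bounds its
-- modulus `r` by `s`.
spectralRadius-≤ : ∀ {m n} {A : Matrix m} {B : Matrix n} {r s} →
  (∀ z → ¬ (z ≈ᶜ 0ℂ) → IsEigenvalue A z → IsEigenvalue B z) →
  IsSpectralRadius A r → IsSpectralRadius B s → ¬ ¬ (r ≤ s)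
spectralRadius-≤ {r = r} {s} A⊆B ρA ρB r≰s =
  let z , z∈A , ∣z∣≈r = IsSpectralRadius.attained ρA
      -- As an attained modulus, `s` is nonnegative; this settles the case `z ≈ᶜ 0ℂ`, where
      -- `r ≈ 0ℝ`.
      _ , _ , 0≤s , _ = IsSpectralRadius.attained ρB
  in r≰s (IsSpectralRadius.maximal ρB
       (A⊆B z (λ z≈0 → r≰s (≤-trans (≈⇒≤ (modulus-0 z≈0 ∣z∣≈r)) 0≤s)) z∈A) ∣z∣≈r)

lemma6p2 : (n ℓ : ℕ) (π : Fin ℓ → Subset n) (part : IsPartition π) (C′ : Matrix n) →
    (∀ a i k → i ∈ π a → k ∈ π a → ∀ j → C′ i j ≈ C′ k j) →
    (∀ z → ¬ (z ≈ᶜ 0ℂ) → IsEigenvalue C′ z ⇔ IsEigenvalue (quotient π part C′) z)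
    × (∀ ρ ρ′ → IsSpectralRadius C′ ρ → IsSpectralRadius (quotient π part C′) ρ′ → ρ ≈ ρ′)
lemma6p2 n ℓ π part C′ rows≈ =
    (λ z z≉0 → mk⇔ (down z z≉0) (up z))
  -- Stability reduces the equality to refuting `ρ≉ρ′`; under that goal both doubly negated
  -- inequalities may be used as if proved.
  , λ ρ ρ′ C′-ρ Q-ρ′ → ≈-stable λ ρ≉ρ′ →
      spectralRadius-≤ down C′-ρ Q-ρ′ λ ρ≤ρ′ →
      spectralRadius-≤ (λ z _ → up z) Q-ρ′ C′-ρ λ ρ′≤ρ →
      ρ≉ρ′ (≤-antisym ρ≤ρ′ ρ′≤ρ)
  where
  down : ∀ z → ¬ (z ≈ᶜ 0ℂ) → IsEigenvalue C′ z → IsEigenvalue (quotient π part C′) z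
  down = eigenvalue-quotient π part C′ rows≈
  up : ∀ z → IsEigenvalue (quotient π part C′) z → IsEigenvalue C′ z
  up = eigenvalue-lift π part C′ rows≈
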